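{- For a finite tree $T$ on $n = |V(T)|$ vertices with domination number $\gamma(T)$ (and $\gamma(T) < n$), let $$s_6(T) = -\frac{\gamma(T) - 1}{2(n - \gamma(T))} + \frac{\gamma(T)+1}{2} - {}^{m}M_2(T),$$ where ${}^{m}M_2(T) = \sum_{uv \in E(T)} \frac{1}{d_u d_v}$ is the modified second Zagreb index of $T$. For each positive integer $k$, let $T_2(k)$ be the tree on $4k$ vertices with vertex set $\bigcup_{i=1}^k \{u_i, v_i, w_i, x_i\}$ and edge set $\left(\bigcup_{i=1}^k \{u_iv_i, v_iw_i, w_ix_i\}\right) \cup \{w_1w_2, w_2w_3, \dots, w_{k-1}w_k\}$. Then $$\lim_{k \to \infty} s_6(T_2(k)) = \infty.$$
   Context: Graphs are finite, simple and undirected; $V(G)$ and $E(G)$ denote the vertex and edge sets of $G$, an edge $\{u,v\}$ is written $uv$, and $d_v$ denotes the degree of the vertex $v$. A dominating set in $G$ is a set $S \subseteq V(G)$ such that every vertex of $G$ is either an element of $S$ or adjacent to an element of $S$; the domination number $\gamma(G)$ is the minimum possible size of a dominating set in $G$. In the definition of $T_2(k)$ the $4k$ named vertices are pairwise distinct. -}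

module Defs where

open import Data.Fin as Fin using (Fin; zero; suc; toℕ; fromℕ; fromℕ<; inject₁; remQuot; combine)
open import Data.Fin.Patterns using (0F; 1F; 2F; 3F)
import Data.Fin.Properties as Fin
open import Data.Fin.Relation.Unary.Top using (view; ‵fromℕ; ‵inject₁)
open import Data.Fin.Subset using (Subset; _∈_; ∣_∣; ⊤; ⁅_⁆; ∁)
import Data.Fin.Subset.Properties as Subset
open import Data.Integer as ℤ using (+_; 1ℤ)
open import Data.Nat as ℕ using (ℕ; zero; suc; NonZero)
import Data.Nat.Properties as ℕ
open import Data.Product using (∃; ∃₂; _×_; _,_; proj₁; proj₂; uncurry)
open import Data.Rational using (ℚ; 0ℚ; -_; _+_; _-_; _/_; _<_)
import Data.Rational.Properties as ℚ
open import Data.Sum using (_⊎_; inj₁; inj₂)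
open import Data.Vec using (tabulate)
open import Data.Vec.Properties using (lookup∘tabulate; lookup⇒[]=)
open import Function using (_on_; _∘_)
open import Function.Definitions using (Injective)
open import Level using (0ℓ)
open import Relation.Binary using (Rel; Decidable; Symmetric; Irreflexive)
open import Relation.Binary.Construct.Closure.ReflexiveTransitive using (Star; ε; _◅_; _◅◅_; gmap; reverse)
open import Relation.Binary.Construct.Closure.Symmetric as Sym using (SymClosure; fwd; bwd)
import Relation.Unary as Unary
open import Relation.Binary.PropositionalEquality
open import Relation.Nullary using (Dec; yes; no; does; ¬_; contradiction; _×-dec_; _⊎-dec_)
open import Relation.Nullary.Decidable using (dec-true; map′)

open import Algebra.Properties.CommutativeMonoid.Sum ℚ.+-0-commutativeMonoid using (sum-syntax)

record Graph : Set₁ where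
  field
    order      : ℕ
    Adj        : Rel (Fin order) 0ℓ
    adj?       : Decidable Adj
    adj-sym    : Symmetric Adj
    adj-irrefl : Irreflexive _≡_ Adj

  Vertex : Set
  Vertex = Fin order

  neighbours : Vertex → Subset order
  neighbours a = tabulate (λ b → does (adj? a b))

  degree : Vertex → ℕ
  degree a = ∣ neighbours a ∣

  adj⇒∈neighbours : ∀ {a b} → Adj a b → b ∈ neighbours a
  adj⇒∈neighbours {a} {b} ab = lookup⇒[]= b _
    (trans (lookup∘tabulate _ b) (dec-true (adj? a b) ab))

  adj⇒degree≢0 : ∀ {a b} → Adj a b → NonZero (degree a)
  adj⇒degree≢0 {a} {b} ab = ℕ.>-nonZero
    (subst (ℕ._≤ degree a) (Subset.∣⁅x⁆∣≡1 b)
      (Subset.p⊆q⇒∣p∣≤∣q∣ λ x∈⁅b⁆ →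
        subst (_∈ neighbours a) (sym (Subset.x∈⁅y⁆⇒x≡y b x∈⁅b⁆)) (adj⇒∈neighbours ab)))

  Dominating : Subset order → Set
  Dominating S = ∀ a → a ∈ S ⊎ ∃ λ b → b ∈ S × Adj a b

  IsDominationNumber : ℕ → Set
  IsDominationNumber m =
    (∃ λ S → Dominating S × ∣ S ∣ ≡ m) × (∀ S → Dominating S → m ℕ.≤ ∣ S ∣)

  dominating? : Unary.Decidable Dominating
  dominating? S = Fin.all? λ a →
    (a Subset.∈? S) ⊎-dec Fin.any? λ b → (b Subset.∈? S) ×-dec adj? a b

private
  least : ∀ {P : ℕ → Set} → Unary.Decidable P → ∀ n → P n →
          ∃ λ m → P m × (∀ j → P j → m ℕ.≤ j)
  least P? n pn with P? 0
  ... | yes p0 = 0 , p0 , λ _ _ → ℕ.z≤n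
  least P? zero    pn | no ¬p0 = contradiction pn ¬p0
  least P? (suc n) pn | no ¬p0 with least (P? ∘ suc) n pn
  ... | m , pm , min = suc m , pm , λ where
    zero    p0 → contradiction p0 ¬p0
    (suc j) pj → ℕ.s≤s (min j pj)

-- Only the specification of the domination number matters, not the search that finds it.
abstract
  dominationNumber : (G : Graph) → ∃ (Graph.IsDominationNumber G)
  dominationNumber G
    with least (λ m → Subset.anySubset? λ S → dominating? S ×-dec (∣ S ∣ ℕ.≟ m))
               order (⊤ , (λ _ → inj₁ Subset.∈⊤) , Subset.∣⊤∣≡n order)
    where open Graph G
  ... | m , attained , min = m , attained , λ S dom → min ∣ S ∣ (S , dom , refl)

γ : Graph → ℕ
γ G = proj₁ (dominationNumber G)

edgeTerm : (G : Graph) → ∀ {a b} → Dec (a Fin.< b × Graph.Adj G a b) → ℚ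
edgeTerm G {a} {b} (yes (_ , ab)) =
  (1ℤ / (degree a ℕ.* degree b))
    {{ℕ.m*n≢0 _ _ {{adj⇒degree≢0 ab}} {{adj⇒degree≢0 (adj-sym ab)}}}}
  where open Graph G
edgeTerm G (no _) = 0ℚ

-- Each edge is counted once, from its smaller to its larger endpoint.
ᵐM₂ : Graph → ℚ
ᵐM₂ G = ∑[ a < order ] ∑[ b < order ] edgeTerm G ((a Fin.<? b) ×-dec adj? a b)
  where open Graph G

record Cycle (G : Graph) : Set where
  open Graph G
  field
    m         : ℕ
    vertex    : Fin (3 ℕ.+ m) → Vertex
    injective : Injective _≡_ _≡_ vertex
    step      : ∀ (i : Fin (2 ℕ.+ m)) → Adj (vertex (inject₁ i)) (vertex (suc i))
    close     : Adj (vertex (fromℕ (2 ℕ.+ m))) (vertex zero)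

record IsTree (G : Graph) : Set where
  open Graph G
  field
    nonEmpty  : NonZero order
    connected : ∀ (a b : Vertex) → Star Adj a b
    acyclic   : ¬ Cycle G

record Tree : Set₁ where
  field
    graph  : Graph
    isTree : IsTree graph
  open Graph graph public
  open IsTree isTree public

s₆ : (T : Tree) → γ (Tree.graph T) ℕ.< Tree.order T → ℚ
s₆ T γ<n =
    - (((+ g ℤ.- 1ℤ) / (2 ℕ.* (n ℕ.∸ g))) {{ℕ.m*n≢0 2 _ {{_}} {{n∸g≢0}}}})
  + (+ g ℤ.+ 1ℤ) / 2
  - ᵐM₂ (Tree.graph T)
  where
  n = Tree.order T
  g = γ (Tree.graph T)
  n∸g≢0 : NonZero (n ℕ.∸ g)
  n∸g≢0 = ℕ.>-nonZero (ℕ.m<n⇒0<n∸m γ<n)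

TendsTo∞ : ((k : ℕ) → .{{NonZero k}} → ℚ) → Set
TendsTo∞ f = ∀ (M : ℚ) → ∃ λ K → ∀ k → .{{_ : NonZero k}} → K ℕ.≤ k → M < f k

edge⇒γ<order : (G : Graph) → ∀ {a b} → Graph.Adj G a b → γ G ℕ.< Graph.order G
edge⇒γ<order G {a} {b} ab = ℕ.≤-<-trans
  (proj₂ (proj₂ (dominationNumber G)) S dominating)
  (subst (ℕ._< order) (sym ∣S∣) (ℕ.∸-monoʳ-< {order} {1} {0} ℕ.z<s 1≤order))
  where
  open Graph G
  S = ∁ ⁅ a ⁆
  ∣S∣ : ∣ S ∣ ≡ order ℕ.∸ 1
  ∣S∣ = trans (Subset.∣∁p∣≡n∸∣p∣ ⁅ a ⁆) (cong (order ℕ.∸_) (Subset.∣⁅x⁆∣≡1 a))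
  1≤order : 1 ℕ.≤ order
  1≤order = ℕ.≤-<-trans ℕ.z≤n (Fin.toℕ<n a)
  other : ∀ {c} → c ≢ a → c ∈ S
  other c≢a = Subset.x∉p⇒x∈∁p (Subset.x≢y⇒x∉⁅y⁆ c≢a)
  dominating : Dominating S
  dominating c with c Fin.≟ a
  ... | no c≢a   = inj₁ (other c≢a)
  ... | yes refl = inj₂ (b , other (λ b≡a → adj-irrefl (sym b≡a) ab) , ab)

-- If every vertex has at most one neighbour of rank no larger than its own, a
-- vertex of maximal rank on a cycle would have two such neighbours.
uniqueLower⇒acyclic : (G : Graph) (rank : Graph.Vertex G → ℕ) →
  (∀ {a b c} → Graph.Adj G a b → Graph.Adj G a c →
   rank b ℕ.≤ rank a → rank c ℕ.≤ rank a → b ≡ c) →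
  ¬ Cycle G
uniqueLower⇒acyclic G rank unique C =
  let i , max                  = argmax (rank ∘ vertex)
      j , l , j≢l , i~j , i~l  = twoNeighbours i
  in j≢l (injective (unique i~j i~l (max j) (max l)))
  where
  open Graph G
  open Cycle C

  argmax : ∀ {n} (f : Fin (suc n) → ℕ) → ∃ λ i → ∀ j → f j ℕ.≤ f i
  argmax {zero}  f = zero , λ where zero → ℕ.≤-refl
  argmax {suc n} f with argmax (f ∘ suc)
  ... | i , max with ℕ.≤-total (f zero) (f (suc i))
  ...   | inj₁ f0≤ = suc i , λ where zero → f0≤ ; (suc j) → max j
  ...   | inj₂ ≤f0 = zero  , λ where zero → ℕ.≤-refl ; (suc j) → ℕ.≤-trans (max j) ≤f0

  twoNeighbours : ∀ i → ∃₂ λ j l →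
    j ≢ l × Adj (vertex i) (vertex j) × Adj (vertex i) (vertex l)
  twoNeighbours i with view i
  ... | ‵fromℕ           = inject₁ (fromℕ _) , zero , (λ ()) , adj-sym (step (fromℕ _)) , close
  ... | ‵inject₁ zero    = fromℕ _ , suc zero , (λ ()) , adj-sym close , step zero
  ... | ‵inject₁ (suc i) =
    inject₁ (inject₁ i) , suc (suc i) , below i , adj-sym (step (inject₁ i)) , step (suc i)
    where
    below : ∀ {n} (i : Fin n) → inject₁ (inject₁ i) ≢ suc (suc i)
    below (suc i) eq = below i (Fin.suc-injective eq)

module T₂-Construction (k : ℕ) where

  Name : Set
  Name = Fin 4 × Fin k

  pattern u i = 0F , i
  pattern v i = 1F , i
  pattern w i = 2F , i
  pattern x i = 3F , i

  data Edge : Rel Name 0ℓ where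
    uv : ∀ i → Edge (u i) (v i)
    vw : ∀ i → Edge (v i) (w i)
    wx : ∀ i → Edge (w i) (x i)
    ww : ∀ {i j} → suc (toℕ i) ≡ toℕ j → Edge (w i) (w j)

  edge? : Decidable Edge
  edge? (u i) (u j) = no λ ()
  edge? (u i) (v j) = map′ (λ where refl → uv i) (λ where (uv _) → refl) (i Fin.≟ j)
  edge? (u i) (w j) = no λ ()
  edge? (u i) (x j) = no λ ()
  edge? (v i) (u j) = no λ ()
  edge? (v i) (v j) = no λ ()
  edge? (v i) (w j) = map′ (λ where refl → vw i) (λ where (vw _) → refl) (i Fin.≟ j)
  edge? (v i) (x j) = no λ ()
  edge? (w i) (u j) = no λ ()
  edge? (w i) (v j) = no λ ()
  edge? (w i) (w j) = map′ ww (λ where (ww eq) → eq) (suc (toℕ i) ℕ.≟ toℕ j)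
  edge? (w i) (x j) = map′ (λ where refl → wx i) (λ where (wx _) → refl) (i Fin.≟ j)
  edge? (x i) (_ , j) = no λ ()

  edge-irrefl : ∀ {p} → ¬ Edge p p
  edge-irrefl (ww eq) = ℕ.1+n≢n eq

  name : Fin (4 ℕ.* k) → Name
  name = remQuot {4} k

  graph : Graph
  graph = record
    { order  = 4 ℕ.* k
    ; Adj    = SymClosure Edge on name
    ; adj?   = λ a b → map′ (λ where (inj₁ e) → fwd e ; (inj₂ e) → bwd e)
                            (λ where (fwd e) → inj₁ e ; (bwd e) → inj₂ e)
                            (edge? (name a) (name b) ⊎-dec edge? (name b) (name a))
    ; adj-sym = Sym.symmetric Edge
    ; adj-irrefl = λ where refl (fwd e) → edge-irrefl e
                           refl (bwd e) → edge-irrefl e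
    }

  private
    named : Name → Fin (4 ℕ.* k)
    named = uncurry combine

    named-name : ∀ a → named (name a) ≡ a
    named-name = Fin.combine-remQuot {4} k

    name-injective : ∀ {a b} → name a ≡ name b → a ≡ b
    name-injective {a} {b} eq = trans (sym (named-name a)) (trans (cong named eq) (named-name b))

    liftAdj : ∀ {p q} → SymClosure Edge p q → Graph.Adj graph (named p) (named q)
    liftAdj {i , j} {i′ , j′} = subst₂ (SymClosure Edge)
      (sym (Fin.remQuot-combine {4} i j)) (sym (Fin.remQuot-combine {4} i′ j′))

    rank : Name → ℕ
    rank (u i) = 2 ℕ.+ toℕ i
    rank (v i) = 1 ℕ.+ toℕ i
    rank (w i) = toℕ i
    rank (x i) = 1 ℕ.+ toℕ i

    data Parent : Rel Name 0ℓ where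
      u↦v : ∀ i → Parent (u i) (v i)
      v↦w : ∀ i → Parent (v i) (w i)
      x↦w : ∀ i → Parent (x i) (w i)
      w↦w : ∀ {i j} → suc (toℕ i) ≡ toℕ j → Parent (w j) (w i)

    parent-unique : ∀ {p q r} → Parent p q → Parent p r → q ≡ r
    parent-unique (u↦v i) (u↦v .i) = refl
    parent-unique (v↦w i) (v↦w .i) = refl
    parent-unique (x↦w i) (x↦w .i) = refl
    parent-unique (w↦w e) (w↦w f)  =
      cong (2F ,_) (Fin.toℕ-injective (ℕ.suc-injective (trans e (sym f))))

    lower⇒parent : ∀ {p q} → SymClosure Edge p q → rank q ℕ.≤ rank p → Parent p q
    lower⇒parent (fwd (uv i))     _ = u↦v i
    lower⇒parent (fwd (vw i))     _ = v↦w i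
    lower⇒parent (fwd (wx i))     h = contradiction h ℕ.1+n≰n
    lower⇒parent (fwd (ww {i} e)) h = contradiction (subst (ℕ._≤ toℕ i) (sym e) h) ℕ.1+n≰n
    lower⇒parent (bwd (uv i))     h = contradiction h ℕ.1+n≰n
    lower⇒parent (bwd (vw i))     h = contradiction h ℕ.1+n≰n
    lower⇒parent (bwd (wx i))     _ = x↦w i
    lower⇒parent (bwd (ww e))     _ = w↦w e

  acyclic : ¬ Cycle graph
  acyclic = uniqueLower⇒acyclic graph (rank ∘ name) λ ab ac b≤a c≤a →
    name-injective (parent-unique (lower⇒parent ab b≤a) (lower⇒parent ac c≤a))

  module _ .{{_ : NonZero k}} where

    private
      0<k : 0 ℕ.< k
      0<k = ℕ.>-nonZero⁻¹ k

      root : Name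
      root = w (fromℕ< 0<k)

      spine : ∀ n (n<k : n ℕ.< k) → Star (SymClosure Edge) (w (fromℕ< n<k)) root
      spine zero    n<k = ε
      spine (suc n) n<k = bwd (ww (trans (cong suc (Fin.toℕ-fromℕ< n<k′)) (sym (Fin.toℕ-fromℕ< n<k))))
                        ◅ spine n n<k′
        where n<k′ = ℕ.<-trans (ℕ.n<1+n n) n<k

      w⟶root : ∀ i → Star (SymClosure Edge) (w i) root
      w⟶root i = subst (λ j → Star (SymClosure Edge) (w j) root)
                       (Fin.fromℕ<-toℕ i (Fin.toℕ<n i)) (spine (toℕ i) (Fin.toℕ<n i))

      toRoot : ∀ p → Star (SymClosure Edge) p root
      toRoot (u i) = fwd (uv i) ◅ fwd (vw i) ◅ w⟶root i
      toRoot (v i) = fwd (vw i) ◅ w⟶root i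
      toRoot (w i) = w⟶root i
      toRoot (x i) = bwd (wx i) ◅ w⟶root i

    connected : ∀ a b → Star (Graph.Adj graph) a b
    connected a b = subst₂ (Star (Graph.Adj graph)) (named-name a) (named-name b)
      (gmap named liftAdj (toRoot (name a) ◅◅ reverse (Sym.symmetric Edge) (toRoot (name b))))

    tree : Tree
    tree = record
      { graph  = graph
      ; isTree = record
        { nonEmpty  = ℕ.m*n≢0 4 k
        ; connected = connected
        ; acyclic   = acyclic
        }
      }

    γ<order : γ graph ℕ.< 4 ℕ.* k
    γ<order = edge⇒γ<order graph (liftAdj (fwd (uv (fromℕ< 0<k))))

T₂ : (k : ℕ) → .{{NonZero k}} → Tree
T₂ k = T₂-Construction.tree k

γ<order-T₂ : (k : ℕ) .{{_ : NonZero k}} → γ (Tree.graph (T₂ k)) ℕ.< Tree.order (T₂ k)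
γ<order-T₂ k = T₂-Construction.γ<order k

{-# OPTIONS --safe #-}
-- The closed neighbourhoods {uᵢ, vᵢ} and {wᵢ, xᵢ} of the leaves partition the vertices, so
-- γ(T₂(k)) = 2k and the first two terms of s₆ sum to at least k − 1. In ᵐM₂ the edges uᵢvᵢ, vᵢwᵢ,
-- wᵢxᵢ, wᵢwᵢ₊₁ contribute at most 1/2 + 1/8 + 1/4 + 1/12 = 23/24 for 1 < i < k, where wᵢ has
-- degree 4, and at most 17/12 for the two end values of i. Hence s₆(T₂(k)) ≥ k/24 − O(1).
module Submission where

open import Defs

open import Data.Bool using (Bool; true; false)
open import Data.Fin as Fin
  using (Fin; zero; suc; toℕ; fromℕ; inject₁; combine; remQuot; _↑ˡ_; _↑ʳ_)
open import Data.Fin.Patterns using (0F; 1F; 2F; 3F)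
import Data.Fin.Properties as Fin
open import Data.Fin.Subset using (Subset; _∈_; _∉_; ∣_∣; ∁)
import Data.Fin.Subset.Properties as Subset
open import Data.Integer as ℤ using (+_; -[1+_]; 1ℤ)
import Data.Integer.Properties as ℤ
open import Data.List as List using ([]; _∷_; length)
import Data.List.Properties as List
open import Data.List.Relation.Unary.All as All using (All; []; _∷_)
import Data.List.Relation.Unary.All.Properties as All
open import Data.List.Relation.Unary.AllPairs using ([]; _∷_)
open import Data.List.Relation.Unary.Unique.Propositional using (Unique)
import Data.List.Relation.Unary.Unique.Propositional.Properties as Unique
open import Data.Nat as ℕ using (ℕ; zero; suc; NonZero; s≤s; z≤n)
import Data.Nat.Properties as ℕ
open import Data.Product using (∃; _×_; _,_; proj₁; proj₂; uncurry)
open import Data.Rational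
  using (ℚ; mkℚ; 0ℚ; 1ℚ; -_; _+_; _-_; _*_; _/_; _≤_; _<_; toℚᵘ; ↥_)
import Data.Rational.Properties as ℚ
open import Data.Rational.Solver using (module +-*-Solver)
open import Data.Rational.Unnormalised as ℚᵘ using (mkℚᵘ)
import Data.Rational.Unnormalised.Properties as ℚᵘ
open import Data.Sum using (_⊎_; inj₁; inj₂)
open import Data.Vec using (tabulate)
open import Data.Vec.Properties using (lookup∘tabulate; lookup⇒[]=; []=⇒lookup)
open import Function using (_∘_)
open import Relation.Binary.Construct.Closure.Symmetric using (SymClosure; fwd; bwd)
open import Relation.Binary.PropositionalEquality
open import Relation.Nullary using (Dec; yes; no; ¬_; contradiction)
open import Relation.Nullary.Decidable using (from-yes; _×-dec_)

open import Algebra.Properties.CommutativeMonoid.Sum ℚ.+-0-commutativeMonoid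
  using (sum; sum-syntax; sum-cong-≗; sum-init-last; ∑-comm; sum-replicate-zero)

-- Fractions and the embedding of the naturals.

-- `/` reduces to lowest terms, so the comparison passes to unnormalised fractions, where
-- cross-multiplication is the order itself.
/-mono-≤ : ∀ p q r s .{{_ : NonZero q}} .{{_ : NonZero s}} →
           p ℤ.* + s ℤ.≤ r ℤ.* + q → p / q ≤ r / s
/-mono-≤ p (suc q) r (suc s) h = ℚ.toℚᵘ-cancel-≤ (begin
  toℚᵘ (p / suc q)  ≃⟨ ℚ.toℚᵘ-fromℚᵘ (mkℚᵘ p q) ⟩
  mkℚᵘ p q          ≤⟨ ℚᵘ.*≤* h ⟩
  mkℚᵘ r s          ≃⟨ ℚ.toℚᵘ-fromℚᵘ (mkℚᵘ r s) ⟨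
  toℚᵘ (r / suc s)  ∎)
  where open ℚᵘ.≤-Reasoning

fromℕ-mono-≤ : ∀ {m n} → m ℕ.≤ n → + m / 1 ≤ + n / 1
fromℕ-mono-≤ {m} {n} m≤n = /-mono-≤ (+ m) 1 (+ n) 1 (ℤ.*-monoʳ-≤-nonNeg (+ 1) (ℤ.+≤+ m≤n))

fromℕ-suc : ∀ n → + suc n / 1 ≡ 1ℚ + + n / 1
fromℕ-suc n = ℚ.toℚᵘ-injective (begin
  toℚᵘ (+ suc n / 1)                ≈⟨ ℚ.toℚᵘ-fromℚᵘ (mkℚᵘ (+ suc n) 0) ⟩
  mkℚᵘ (+ suc n) 0                  ≈⟨ ℚᵘ.*≡* (cong (λ z → (+ 1 ℤ.+ z) ℤ.* + 1) (sym (ℤ.*-identityʳ (+ n)))) ⟩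
  mkℚᵘ (+ 1) 0 ℚᵘ.+ mkℚᵘ (+ n) 0    ≈⟨ ℚᵘ.+-congʳ (mkℚᵘ (+ 1) 0) (ℚ.toℚᵘ-fromℚᵘ (mkℚᵘ (+ n) 0)) ⟨
  toℚᵘ 1ℚ ℚᵘ.+ toℚᵘ (+ n / 1)       ≈⟨ ℚ.toℚᵘ-homo-+ 1ℚ (+ n / 1) ⟨
  toℚᵘ (1ℚ + + n / 1)               ∎)
  where open import Relation.Binary.Reasoning.Setoid ℚᵘ.≃-setoid

fromℕ-* : ∀ m n → + (m ℕ.* n) / 1 ≡ + m / 1 * (+ n / 1)
fromℕ-* m n = ℚ.toℚᵘ-injective (begin
  toℚᵘ (+ (m ℕ.* n) / 1)              ≈⟨ ℚ.toℚᵘ-fromℚᵘ (mkℚᵘ (+ (m ℕ.* n)) 0) ⟩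
  mkℚᵘ (+ (m ℕ.* n)) 0                ≈⟨ ℚᵘ.*≡* (cong (ℤ._* + 1) (ℤ.pos-* m n)) ⟩
  mkℚᵘ (+ m) 0 ℚᵘ.* mkℚᵘ (+ n) 0      ≈⟨ ℚᵘ.*-cong (ℚ.toℚᵘ-fromℚᵘ (mkℚᵘ (+ m) 0)) (ℚ.toℚᵘ-fromℚᵘ (mkℚᵘ (+ n) 0)) ⟨
  toℚᵘ (+ m / 1) ℚᵘ.* toℚᵘ (+ n / 1)  ≈⟨ ℚ.toℚᵘ-homo-* (+ m / 1) (+ n / 1) ⟨
  toℚᵘ (+ m / 1 * (+ n / 1))          ∎)
  where open import Relation.Binary.Reasoning.Setoid ℚᵘ.≃-setoid

-- The denominator is at least 1. `theorem2` uses this to replace the rational threshold by a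
-- natural number.
≤∣numerator∣ : ∀ p → p ≤ + ℤ.∣ ↥ p ∣ / 1
≤∣numerator∣ p@(mkℚ n d-1 _) = begin
  p                          ≡⟨ ℚ.fromℚᵘ-toℚᵘ p ⟨
  n / suc d-1                ≤⟨ /-mono-≤ n (suc d-1) (+ ℤ.∣ n ∣) 1 (numerator≤ n) ⟩
  + ℤ.∣ n ∣ / 1              ∎
  where
  open ℚ.≤-Reasoning
  numerator≤ : ∀ n → n ℤ.* + 1 ℤ.≤ + ℤ.∣ n ∣ ℤ.* + suc d-1
  numerator≤ (+ n)    = ℤ.*-monoˡ-≤-nonNeg (+ n) (ℤ.+≤+ (s≤s z≤n))
  numerator≤ -[1+ n ] = ℤ.-≤+

[n-1]/d≤1 : ∀ {n} d .{{_ : NonZero d}} → n ℕ.≤ d → (+ n ℤ.- 1ℤ) / d ≤ 1ℚ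
[n-1]/d≤1 {n} d n≤d = /-mono-≤ (+ n ℤ.- 1ℤ) d 1ℤ 1 (begin
  (+ n ℤ.- 1ℤ) ℤ.* + 1  ≡⟨ ℤ.*-identityʳ (+ n ℤ.- 1ℤ) ⟩
  + n ℤ.- 1ℤ            ≤⟨ ℤ.i-j≤i (+ n) 1ℤ ⟩
  + n                   ≤⟨ ℤ.+≤+ n≤d ⟩
  + d                   ≡⟨ ℤ.*-identityˡ (+ d) ⟨
  1ℤ ℤ.* + d            ∎)
  where open ℤ.≤-Reasoning

n≤[2n+1]/2 : ∀ n → + n / 1 ≤ (+ (2 ℕ.* n) ℤ.+ 1ℤ) / 2
n≤[2n+1]/2 n = /-mono-≤ (+ n) 1 (+ (2 ℕ.* n) ℤ.+ 1ℤ) 2 (begin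
  + n ℤ.* + 2                        ≡⟨ ℤ.*-comm (+ n) (+ 2) ⟩
  + 2 ℤ.* + n                        ≡⟨ ℤ.pos-* 2 n ⟨
  + (2 ℕ.* n)                        ≤⟨ ℤ.i≤i+j (+ (2 ℕ.* n)) 1ℤ ⟩
  + (2 ℕ.* n) ℤ.+ 1ℤ                 ≡⟨ ℤ.*-identityʳ (+ (2 ℕ.* n) ℤ.+ 1ℤ) ⟨
  (+ (2 ℕ.* n) ℤ.+ 1ℤ) ℤ.* + 1       ∎)
  where open ℤ.≤-Reasoning

-- Finite sums of rationals.

sum-mono-≤ : ∀ {n} {f g : Fin n → ℚ} → (∀ i → f i ≤ g i) → sum f ≤ sum g
sum-mono-≤ {zero}  f≤g = ℚ.≤-refl
sum-mono-≤ {suc n} f≤g = ℚ.+-mono-≤ (f≤g zero) (sum-mono-≤ (f≤g ∘ suc))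

sum-≤-const : ∀ {n} {f : Fin n → ℚ} c → (∀ i → f i ≤ c) → sum f ≤ + n / 1 * c
sum-≤-const {zero}      c f≤c = ℚ.≤-reflexive (sym (ℚ.*-zeroˡ c))
sum-≤-const {suc n} {f} c f≤c = begin
  sum f                  ≤⟨ ℚ.+-mono-≤ (f≤c zero) (sum-≤-const c (f≤c ∘ suc)) ⟩
  c + + n / 1 * c        ≡⟨ cong (λ z → z + + n / 1 * c) (ℚ.*-identityˡ c) ⟨
  1ℚ * c + + n / 1 * c   ≡⟨ ℚ.*-distribʳ-+ c 1ℚ (+ n / 1) ⟨
  (1ℚ + + n / 1) * c     ≡⟨ cong (_* c) (fromℕ-suc n) ⟨
  + suc n / 1 * c        ∎
  where open ℚ.≤-Reasoning

sum-zero : ∀ {n} {f : Fin n → ℚ} → (∀ i → f i ≡ 0ℚ) → sum f ≡ 0ℚ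
sum-zero {n} f≡0 = trans (sum-cong-≗ f≡0) (sum-replicate-zero n)

-- Two indices satisfying `R` coincide, so at most one summand survives; `0ℚ ≤ c` covers the case
-- where none does.
sum-≤-unique : ∀ {n} {f : Fin n → ℚ} {R : Fin n → Set} {c} → (∀ i → Dec (R i)) →
               (∀ {i j} → R i → R j → i ≡ j) → (∀ {i} → R i → f i ≤ c) →
               (∀ {i} → ¬ R i → f i ≡ 0ℚ) → 0ℚ ≤ c → sum f ≤ c
sum-≤-unique {zero}  R? unique f≤c f≡0 0≤c = 0≤c
sum-≤-unique {suc n} {f} {R} {c} R? unique f≤c f≡0 0≤c with R? zero
... | yes r = begin
  f zero + sum (f ∘ suc)  ≡⟨ cong (_+_ (f zero)) (sum-zero λ i → f≡0 {suc i} λ r′ → Fin.0≢1+n (unique r r′)) ⟩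
  f zero + 0ℚ             ≡⟨ ℚ.+-identityʳ (f zero) ⟩
  f zero                  ≤⟨ f≤c r ⟩
  c                       ∎
  where open ℚ.≤-Reasoning
... | no ¬r = begin
  f zero + sum (f ∘ suc)  ≡⟨ cong (λ z → z + sum (f ∘ suc)) (f≡0 ¬r) ⟩
  0ℚ + sum (f ∘ suc)      ≡⟨ ℚ.+-identityˡ (sum (f ∘ suc)) ⟩
  sum (f ∘ suc)           ≤⟨ sum-≤-unique (R? ∘ suc) (λ r r′ → Fin.suc-injective (unique r r′)) f≤c f≡0 0≤c ⟩
  c                       ∎
  where open ℚ.≤-Reasoning

sum-↑ : ∀ m {n} (f : Fin (m ℕ.+ n) → ℚ) →
        sum f ≡ ∑[ i < m ] f (i ↑ˡ n) + ∑[ j < n ] f (m ↑ʳ j)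
sum-↑ zero    f = sym (ℚ.+-identityˡ (sum f))
sum-↑ (suc m) {n} f = trans (cong (_+_ (f zero)) (sum-↑ m (f ∘ suc)))
  (sym (ℚ.+-assoc (f zero) (∑[ i < m ] f (suc (i ↑ˡ n))) (∑[ j < n ] f (suc (m ↑ʳ j)))))

-- `combine` lists `Fin (m ℕ.* n)` as `m` consecutive blocks of length `n`; each step splits off the
-- first block with `sum-↑`.
sum-combine : ∀ m {n} (f : Fin (m ℕ.* n) → ℚ) →
              sum f ≡ ∑[ i < m ] ∑[ j < n ] f (combine i j)
sum-combine zero        f = refl
sum-combine (suc m) {n} f =
  trans (sum-↑ n f) (cong (_+_ (∑[ j < n ] f (j ↑ˡ (m ℕ.* n)))) (sum-combine m (f ∘ (n ↑ʳ_))))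

-- Reciprocals of naturals.

recip : ℕ → ℚ
recip zero    = 0ℚ
recip (suc n) = 1ℤ / suc n

0≤recip : ∀ n → 0ℚ ≤ recip n
0≤recip zero    = ℚ.≤-refl
0≤recip (suc n) = /-mono-≤ (+ 0) 1 1ℤ (suc n) (ℤ.+≤+ z≤n)

1/-≤-recip : ∀ {m n} .{{_ : NonZero m}} .{{_ : NonZero n}} → m ℕ.≤ n → 1ℤ / n ≤ recip m
1/-≤-recip {suc m} {n} m≤n = /-mono-≤ 1ℤ n 1ℤ (suc m) (ℤ.*-monoˡ-≤-nonNeg 1ℤ (ℤ.+≤+ m≤n))

-- Lower bounds for cardinalities.

-- Deleting the head from `p` lowers its size by at least one and keeps the later entries, which
-- differ from the head.
length≤∣p∣ : ∀ {n} {p : Subset n} {xs} → Unique xs → All (_∈ p) xs → length xs ℕ.≤ ∣ p ∣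
length≤∣p∣ []         []          = z≤n
length≤∣p∣ (x≢ ∷ uxs) (x∈p ∷ xs∈p) = ℕ.≤-trans
  (s≤s (length≤∣p∣ uxs (All.zipWith (λ (x≢y , y∈p) → Subset.x∈p∧x≢y⇒x∈p-y y∈p (≢-sym x≢y)) (x≢ , xs∈p))))
  (Subset.x∈p⇒∣p-x∣<∣p∣ x∈p)

-- Choosing a preimage in `p` for each value gives an injective section of `h`, hence `m` distinct
-- elements of `p`.
surjective⇒≤∣p∣ : ∀ {m n} {p : Subset n} (h : Fin n → Fin m) →
                  (∀ y → ∃ λ x → x ∈ p × h x ≡ y) → m ℕ.≤ ∣ p ∣
surjective⇒≤∣p∣ {m} {p = p} h onto = subst (ℕ._≤ ∣ p ∣) (List.length-tabulate section)
  (length≤∣p∣ (Unique.tabulate⁺ injective) (All.tabulate⁺ (proj₁ ∘ proj₂ ∘ onto)))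
  where
  section : Fin m → Fin _
  section = proj₁ ∘ onto
  injective : ∀ {y z} → section y ≡ section z → y ≡ z
  injective {y} {z} eq =
    trans (sym (proj₂ (proj₂ (onto y)))) (trans (cong h eq) (proj₂ (proj₂ (onto z))))

-- Edge weights.

module _ (G : Graph) where
  open Graph G

  edgeWeight : Vertex → Vertex → ℚ
  edgeWeight a b = edgeTerm G ((a Fin.<? b) ×-dec adj? a b)

  -- Larger degrees only shrink a weight, so lower bounds for degrees bound `ᵐM₂` from above; a pair
  -- that is not counted has weight 0.
  edgeWeight-≤ : ∀ a b p q .{{_ : NonZero p}} .{{_ : NonZero q}} →
                 p ℕ.≤ degree a → q ℕ.≤ degree b → edgeWeight a b ≤ recip (p ℕ.* q)
  edgeWeight-≤ a b p q p≤ q≤ with (a Fin.<? b) ×-dec adj? a b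
  ... | yes (_ , ab) = 1/-≤-recip {{ℕ.m*n≢0 p q}}
    {{ℕ.m*n≢0 _ _ {{adj⇒degree≢0 ab}} {{adj⇒degree≢0 (adj-sym ab)}}}} (ℕ.*-mono-≤ p≤ q≤)
  ... | no _         = 0≤recip (p ℕ.* q)

  edgeWeight≡0 : ∀ a b → ¬ (a Fin.< b × Adj a b) → edgeWeight a b ≡ 0ℚ
  edgeWeight≡0 a b ¬ab with (a Fin.<? b) ×-dec adj? a b
  ... | yes ab = contradiction ab ¬ab
  ... | no _   = refl

-- Lower bounds for d_p d_q over the edges pq of T₂(k), by the kinds of p and q, when δ is a
-- lower bound for the degree of the w-vertex of p; 0 where there is no edge, as recip 0 = 0.
degreeProduct : ℕ → Fin 4 → Fin 4 → ℕ
degreeProduct δ 0F 1F = 1 ℕ.* 2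
degreeProduct δ 1F 2F = 2 ℕ.* δ
degreeProduct δ 2F 3F = δ ℕ.* 1
degreeProduct δ 2F 2F = δ ℕ.* 3
degreeProduct δ _  _  = 0

module _ (k : ℕ) where
  open T₂-Construction k
  open Graph graph

  named : Name → Vertex
  named = uncurry combine

  name-named : ∀ p → name (named p) ≡ p
  name-named = uncurry Fin.remQuot-combine

  named-name : ∀ a → named (name a) ≡ a
  named-name = Fin.combine-remQuot {4} k

  named-injective : ∀ {p q} → named p ≡ named q → p ≡ q
  named-injective {p} {q} eq = trans (sym (name-named p)) (trans (cong name eq) (name-named q))

  named-adj : ∀ {p q} → SymClosure Edge p q → Adj (named p) (named q)
  named-adj {p} {q} = subst₂ (SymClosure Edge) (sym (name-named p)) (sym (name-named q))

  -- The domination number of T₂(k).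

  -- The index of the part {uᵢ, vᵢ} or {wᵢ, xᵢ} that contains a vertex. The same indices number the
  -- leaves, through `leafOf`.
  cell : Name → Fin (2 ℕ.* k)
  cell (0F , i) = combine {2} 0F i
  cell (1F , i) = combine {2} 0F i
  cell (2F , i) = combine {2} 1F i
  cell (3F , i) = combine {2} 1F i

  leaf : Fin 2 × Fin k → Name
  leaf (0F , i) = u i
  leaf (1F , i) = x i

  cell-leaf : ∀ q → cell (leaf q) ≡ uncurry combine q
  cell-leaf (0F , i) = refl
  cell-leaf (1F , i) = refl

  -- The only edge at uᵢ is uᵢvᵢ and the only one at xᵢ is wᵢxᵢ; unification rules out all others.
  cell-leaf-neighbour : ∀ q {p} → SymClosure Edge (leaf q) p → cell p ≡ uncurry combine q
  cell-leaf-neighbour (0F , i) (fwd (uv .i)) = refl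
  cell-leaf-neighbour (1F , i) (bwd (wx .i)) = refl

  leafOf : Fin (2 ℕ.* k) → Vertex
  leafOf y = named (leaf (remQuot k y))

  name-leafOf : ∀ y → name (leafOf y) ≡ leaf (remQuot k y)
  name-leafOf y = name-named (leaf (remQuot k y))

  cell-leafOf : ∀ y → cell (name (leafOf y)) ≡ y
  cell-leafOf y = trans (cong cell (name-leafOf y))
    (trans (cell-leaf (remQuot k y)) (Fin.combine-remQuot {2} k y))

  -- Whatever dominates a leaf lies in the part of that leaf, so `S` meets each of the 2k fibres of
  -- `cell`.
  2k≤∣dominating∣ : ∀ S → Dominating S → 2 ℕ.* k ℕ.≤ ∣ S ∣
  2k≤∣dominating∣ S dom = surjective⇒≤∣p∣ (cell ∘ name) onto
    where
    onto : ∀ y → ∃ λ b → b ∈ S × cell (name b) ≡ y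
    onto y with dom (leafOf y)
    ... | inj₁ a∈S            = leafOf y , a∈S , cell-leafOf y
    ... | inj₂ (b , b∈S , ab) = b , b∈S , trans
      (cell-leaf-neighbour (remQuot k y) (subst (λ p → SymClosure Edge p (name b)) (name-leafOf y) ab))
      (Fin.combine-remQuot {2} k y)

  isInner : Name → Bool
  isInner (u _) = false
  isInner (v _) = true
  isInner (w _) = true
  isInner (x _) = false

  inner : Subset order
  inner = tabulate (isInner ∘ name)

  ∈inner : ∀ {a} → isInner (name a) ≡ true → a ∈ inner
  ∈inner {a} eq = lookup⇒[]= a inner (trans (lookup∘tabulate (isInner ∘ name) a) eq)

  named∈inner : ∀ p → isInner p ≡ true → named p ∈ inner
  named∈inner p eq = ∈inner (trans (cong isInner (name-named p)) eq)

  leafOf∉inner : ∀ y → leafOf y ∉ inner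
  leafOf∉inner y a∈ = false≢true (trans (sym (isInner-leaf (remQuot k y))) (trans
    (cong isInner (sym (name-leafOf y)))
    (trans (sym (lookup∘tabulate (isInner ∘ name) (leafOf y))) ([]=⇒lookup a∈))))
    where
    false≢true : false ≢ true
    false≢true ()
    isInner-leaf : ∀ q → isInner (leaf q) ≡ false
    isInner-leaf (0F , i) = refl
    isInner-leaf (1F , i) = refl

  inner-dominating : Dominating inner
  inner-dominating a = subst Dominated (named-name a) (dominated (name a))
    where
    Dominated : Vertex → Set
    Dominated a = a ∈ inner ⊎ ∃ λ b → b ∈ inner × Adj a b
    dominated : ∀ p → Dominated (named p)
    dominated (u i) = inj₂ (named (v i) , named∈inner (v i) refl , named-adj (fwd (uv i)))
    dominated (v i) = inj₁ (named∈inner (v i) refl)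
    dominated (w i) = inj₁ (named∈inner (w i) refl)
    dominated (x i) = inj₂ (named (w i) , named∈inner (w i) refl , named-adj (bwd (wx i)))

  -- The complement is counted instead: it contains the leaf of each part, hence at least 2k of the
  -- 4k vertices.
  ∣inner∣≤2k : ∣ inner ∣ ℕ.≤ 2 ℕ.* k
  ∣inner∣≤2k = ℕ.+-cancelʳ-≤ (2 ℕ.* k) _ _ (begin
    ∣ inner ∣ ℕ.+ 2 ℕ.* k            ≤⟨ ℕ.+-monoʳ-≤ ∣ inner ∣ 2k≤∣∁inner∣ ⟩
    ∣ inner ∣ ℕ.+ ∣ ∁ inner ∣        ≡⟨ cong (∣ inner ∣ ℕ.+_) (Subset.∣∁p∣≡n∸∣p∣ inner) ⟩
    ∣ inner ∣ ℕ.+ (order ℕ.∸ ∣ inner ∣) ≡⟨ ℕ.m+[n∸m]≡n (Subset.∣p∣≤n inner) ⟩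
    4 ℕ.* k                          ≡⟨ ℕ.*-distribʳ-+ k 2 2 ⟩
    2 ℕ.* k ℕ.+ 2 ℕ.* k              ∎)
    where
    open ℕ.≤-Reasoning
    2k≤∣∁inner∣ : 2 ℕ.* k ℕ.≤ ∣ ∁ inner ∣
    2k≤∣∁inner∣ = surjective⇒≤∣p∣ (cell ∘ name) λ y →
      leafOf y , Subset.x∉p⇒x∈∁p (leafOf∉inner y) , cell-leafOf y

  γ≡2k : γ graph ≡ 2 ℕ.* k
  γ≡2k with dominationNumber graph
  ... | m , (S , dom , ∣S∣≡m) , min = ℕ.≤-antisym
    (ℕ.≤-trans (min inner inner-dominating) ∣inner∣≤2k)
    (subst (2 ℕ.* k ℕ.≤_) ∣S∣≡m (2k≤∣dominating∣ S dom))

  -- Degrees in T₂(k).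

  -- Listing distinct neighbours bounds a degree from below, the direction that `edgeWeight-≤`
  -- requires.
  length≤degree : ∀ {p} qs → Unique qs → All (SymClosure Edge p) qs → length qs ℕ.≤ degree (named p)
  length≤degree {p} qs uqs adj = subst (ℕ._≤ degree (named p)) (List.length-map named qs)
    (length≤∣p∣ (Unique.map⁺ named-injective uqs)
      (All.map⁺ (All.map (λ e → adj⇒∈neighbours (named-adj e)) adj)))

  1≤degree-u : ∀ i → 1 ℕ.≤ degree (named (u i))
  1≤degree-u i = length≤degree (v i ∷ []) ([] ∷ []) (fwd (uv i) ∷ [])

  2≤degree-v : ∀ i → 2 ℕ.≤ degree (named (v i))
  2≤degree-v i = length≤degree (u i ∷ w i ∷ []) (((λ ()) ∷ []) ∷ [] ∷ []) (bwd (uv i) ∷ fwd (vw i) ∷ [])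

  1≤degree-x : ∀ i → 1 ℕ.≤ degree (named (x i))
  1≤degree-x i = length≤degree (w i ∷ []) ([] ∷ []) (bwd (wx i) ∷ [])

  2≤degree-w : ∀ i → 2 ℕ.≤ degree (named (w i))
  2≤degree-w i = length≤degree (v i ∷ x i ∷ []) (((λ ()) ∷ []) ∷ [] ∷ []) (bwd (vw i) ∷ fwd (wx i) ∷ [])

  3≤degree-w : ∀ {i j} → suc (toℕ i) ≡ toℕ j → 3 ℕ.≤ degree (named (w j))
  3≤degree-w {i} {j} ij = length≤degree (v j ∷ x j ∷ w i ∷ [])
    (((λ ()) ∷ (λ ()) ∷ []) ∷ ((λ ()) ∷ []) ∷ [] ∷ [])
    (bwd (vw j) ∷ fwd (wx j) ∷ bwd (ww ij) ∷ [])

  4≤degree-w : ∀ {i j l} → suc (toℕ i) ≡ toℕ j → suc (toℕ j) ≡ toℕ l → 4 ℕ.≤ degree (named (w j))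
  4≤degree-w {i} {j} {l} ij jl = length≤degree (v j ∷ x j ∷ w i ∷ w l ∷ [])
    (((λ ()) ∷ (λ ()) ∷ (λ ()) ∷ []) ∷ ((λ ()) ∷ (λ ()) ∷ []) ∷ (wi≢wl ∷ []) ∷ [] ∷ [])
    (bwd (vw j) ∷ fwd (wx j) ∷ bwd (ww ij) ∷ fwd (ww jl) ∷ [])
    where
    wi≢wl : _≢_ {A = Name} (w i) (w l)
    wi≢wl refl = ℕ.m≢1+n+m (toℕ i) {1} (sym (trans (cong suc ij) jl))

  -- The edge sum of T₂(k).

  -- `combine` orders vertices by kind first and index second, and every constructor of `Edge` goes
  -- up in this order. Hence `ᵐM₂`, which counts an edge from its smaller endpoint, counts it in the
  -- direction of `Edge`.
  edge⇒< : ∀ {p q} → Edge p q → named p Fin.< named q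
  edge⇒< (uv i) = Fin.combine-monoˡ-< {4} {i = 0F} {1F} i i (s≤s z≤n)
  edge⇒< (vw i) = Fin.combine-monoˡ-< {4} {i = 1F} {2F} i i (s≤s (s≤s z≤n))
  edge⇒< (wx i) = Fin.combine-monoˡ-< {4} {i = 2F} {3F} i i (s≤s (s≤s (s≤s z≤n)))
  edge⇒< (ww {i} {j} ij) = subst₂ ℕ._<_ (sym (Fin.toℕ-combine {4} 2F i)) (sym (Fin.toℕ-combine {4} 2F j))
    (ℕ.+-monoʳ-< (k ℕ.* 2) (ℕ.≤-reflexive ij))

  <∧adj⇒edge : ∀ {p q} → named p Fin.< named q × Adj (named p) (named q) → Edge p q
  <∧adj⇒edge {p} {q} (p<q , pq) with subst₂ (SymClosure Edge) (name-named p) (name-named q) pq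
  ... | fwd e = e
  ... | bwd e = contradiction p<q (Fin.<-asym (edge⇒< e))

  -- As `Edge` is directed, a spine edge leaves wᵢ only towards wᵢ₊₁. This is the uniqueness that
  -- `sum-≤-unique` asks for.
  edge-uniqueʳ : ∀ {s i t j j′} → Edge (s , i) (t , j) → Edge (s , i) (t , j′) → j ≡ j′
  edge-uniqueʳ (uv i) (uv .i)  = refl
  edge-uniqueʳ (vw i) (vw .i)  = refl
  edge-uniqueʳ (wx i) (wx .i)  = refl
  edge-uniqueʳ (ww ij) (ww ij′) = Fin.toℕ-injective (trans (sym ij) ij′)

  term : Name → Name → ℚ
  term p q = edgeWeight graph (named p) (named q)

  term-≤ : ∀ δ .{{_ : NonZero δ}} {s i t j} → δ ℕ.≤ degree (named (w i)) →
           Edge (s , i) (t , j) → term (s , i) (t , j) ≤ recip (degreeProduct δ s t)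
  term-≤ δ δ≤ (uv i)          = edgeWeight-≤ graph (named (u i)) (named (v i)) 1 2 (1≤degree-u i) (2≤degree-v i)
  term-≤ δ δ≤ (vw i)          = edgeWeight-≤ graph (named (v i)) (named (w i)) 2 δ (2≤degree-v i) δ≤
  term-≤ δ δ≤ (wx i)          = edgeWeight-≤ graph (named (w i)) (named (x i)) δ 1 δ≤ (1≤degree-x i)
  -- The far endpoint has a predecessor on the spine, so its degree is at least 3 even at the last
  -- index.
  term-≤ δ δ≤ (ww {i} {j} ij) = edgeWeight-≤ graph (named (w i)) (named (w j)) δ 3 δ≤ (3≤degree-w ij)

  -- The share of `ᵐM₂` due to the edges whose smaller endpoint has index `i`: uᵢvᵢ, vᵢwᵢ, wᵢxᵢ and,
  -- for all but the last index, wᵢwᵢ₊₁.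
  load : Fin k → ℚ
  load i = ∑[ s < 4 ] ∑[ t < 4 ] ∑[ j < k ] term (s , i) (t , j)

  -- For fixed kinds `s` and `t` at most one `j` gives an edge, so each sum over `j` collapses to
  -- one entry of the table. For a numeral `δ` the bound evaluates to a closed fraction.
  load-≤ : ∀ δ .{{_ : NonZero δ}} i → δ ℕ.≤ degree (named (w i)) →
           load i ≤ ∑[ s < 4 ] ∑[ t < 4 ] recip (degreeProduct δ s t)
  load-≤ δ i δ≤ = sum-mono-≤ λ s → sum-mono-≤ λ t →
    sum-≤-unique (λ j → edge? (s , i) (t , j)) edge-uniqueʳ
      (term-≤ δ {s} {i} {t} δ≤)
      (λ {j} ¬e → edgeWeight≡0 graph (named (s , i)) (named (t , j)) (¬e ∘ <∧adj⇒edge {s , i} {t , j}))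
      (0≤recip (degreeProduct δ s t))

  ᵐM₂≡∑load : ᵐM₂ graph ≡ ∑[ i < k ] load i
  ᵐM₂≡∑load = begin
    ᵐM₂ graph
      ≡⟨ sum-combine 4 {k} (λ a → ∑[ b < order ] edgeWeight graph a b) ⟩
    ∑[ s < 4 ] ∑[ i < k ] ∑[ b < 4 ℕ.* k ] edgeWeight graph (named (s , i)) b
      ≡⟨ sum-cong-≗ {4} (λ s → sum-cong-≗ {k} λ i → sum-combine 4 {k} (edgeWeight graph (named (s , i)))) ⟩
    ∑[ s < 4 ] ∑[ i < k ] ∑[ t < 4 ] ∑[ j < k ] term (s , i) (t , j)
      ≡⟨ ∑-comm {4} {k} (λ s i → ∑[ t < 4 ] ∑[ j < k ] term (s , i) (t , j)) ⟩
    ∑[ i < k ] load i ∎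
    where open ≡-Reasoning

-- Growth of s₆.

-- Writing k as 2 + m separates the two end indices, whose loads give 17/6 = 2 · 17/12, from the m
-- interior ones.
ᵐM₂-≤ : ∀ m → ᵐM₂ (T₂-Construction.graph (2 ℕ.+ m)) ≤ + m / 1 * (+ 23 / 24) + + 17 / 6
ᵐM₂-≤ m = begin
  ᵐM₂ (T₂-Construction.graph k)
    ≡⟨ ᵐM₂≡∑load k ⟩
  load k zero + ∑[ i < suc m ] load k (suc i)
    ≡⟨ cong (_+_ (load k zero)) (sum-init-last (load k ∘ suc)) ⟩
  load k zero + (∑[ i < m ] load k (suc (inject₁ i)) + load k (suc (fromℕ m)))
    ≤⟨ ℚ.+-mono-≤ (end zero) (ℚ.+-mono-≤ (sum-≤-const (+ 23 / 24) interior) (end (suc (fromℕ m)))) ⟩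
  + 17 / 12 + (+ m / 1 * (+ 23 / 24) + + 17 / 12)
    ≡⟨ solve 1 (λ z → con (+ 17 / 12) :+ (z :+ con (+ 17 / 12)) := z :+ con (+ 17 / 6)) refl (+ m / 1 * (+ 23 / 24)) ⟩
  + m / 1 * (+ 23 / 24) + + 17 / 6 ∎
  where
  open ℚ.≤-Reasoning
  open +-*-Solver
  k = 2 ℕ.+ m
  end : ∀ i → load k i ≤ + 17 / 12
  -- 1/2 + 1/4 + 1/2 + 1/6. This also bounds the load of the last index, where the spine edge is
  -- absent.
  end i = load-≤ k 2 i (2≤degree-w k i)
  interior : ∀ i → load k (suc (inject₁ i)) ≤ + 23 / 24
  -- The spine vertex numbered i + 1 has neighbours numbered i and i + 2, both within range.
  interior i = load-≤ k 4 (suc (inject₁ i))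
    (4≤degree-w k {inject₁ (inject₁ i)} {suc (inject₁ i)} {suc (suc i)}
      (cong suc (Fin.toℕ-inject₁ (inject₁ i))) (cong (2 ℕ.+_) (Fin.toℕ-inject₁ i)))

-- As γ = 2k, the first fraction is (2k - 1)/(4k) ≤ 1 and the second is k + 1/2 ≥ k.
s₆-≥ : ∀ k .{{_ : NonZero k}} →
       - 1ℚ + + k / 1 - ᵐM₂ (T₂-Construction.graph k) ≤ s₆ (T₂ k) (γ<order-T₂ k)
s₆-≥ k = ℚ.+-monoˡ-≤ (- ᵐM₂ (T₂-Construction.graph k)) (ℚ.+-mono-≤
  -- `g` stays in the denominator, whose nonzero proof mentions it; `γ≡2k` enters through
  -- `g≤2[4k∸g]`.
  (ℚ.neg-antimono-≤ ([n-1]/d≤1 (2 ℕ.* (4 ℕ.* k ℕ.∸ g)) {{_}} g≤2[4k∸g]))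
  (subst (λ g → + k / 1 ≤ (+ g ℤ.+ 1ℤ) / 2) (sym (γ≡2k k)) (n≤[2n+1]/2 k)))
  where
  g = γ (T₂-Construction.graph k)
  g≤2[4k∸g] : g ℕ.≤ 2 ℕ.* (4 ℕ.* k ℕ.∸ g)
  g≤2[4k∸g] = begin
    g                            ≡⟨ γ≡2k k ⟩
    2 ℕ.* k                      ≤⟨ ℕ.m≤n*m (2 ℕ.* k) 2 ⟩
    2 ℕ.* (2 ℕ.* k)              ≡⟨ cong (2 ℕ.*_) (ℕ.*-distribʳ-∸ k 4 2) ⟩
    2 ℕ.* (4 ℕ.* k ℕ.∸ 2 ℕ.* k)  ≡⟨ cong (λ n → 2 ℕ.* (4 ℕ.* k ℕ.∸ n)) (γ≡2k k) ⟨
    2 ℕ.* (4 ℕ.* k ℕ.∸ g)        ∎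
    where open ℕ.≤-Reasoning

theorem2 : TendsTo∞ (λ k → s₆ (T₂ k) (γ<order-T₂ k))
-- For k = 2 + m the bounds give s₆ ≥ m/24 - 11/6, and m ≥ 24(2 + a) makes this at least a + 1/6,
-- which exceeds a ≥ M.
theorem2 M = 2 ℕ.+ (2 ℕ.+ a) ℕ.* 24 , eventually
  where
  a = ℤ.∣ ↥ M ∣
  eventually : ∀ k .{{_ : NonZero k}} → 2 ℕ.+ (2 ℕ.+ a) ℕ.* 24 ℕ.≤ k → M < s₆ (T₂ k) (γ<order-T₂ k)
  -- Here `a≤m` proves `(2 ℕ.+ a) ℕ.* 24 ℕ.≤ m`.
  eventually k@(suc (suc m)) (s≤s (s≤s a≤m)) = begin-strict
    M
      ≤⟨ ≤∣numerator∣ M ⟩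
    ι a
      ≡⟨ ℚ.+-identityʳ (ι a) ⟨
    ι a + 0ℚ
      <⟨ ℚ.+-monoʳ-< (ι a) (from-yes (0ℚ ℚ.<? + 1 / 6)) ⟩
    ι a + + 1 / 6
      ≡⟨ solve 1 (λ z → z :+ con (+ 1 / 6)
                     := (con 1ℚ :+ (con 1ℚ :+ z)) :* con (+ 24 / 1) :* con (+ 1 / 24) :- con (+ 11 / 6))
               refl (ι a) ⟩
    (1ℚ + (1ℚ + ι a)) * (+ 24 / 1) * (+ 1 / 24) - + 11 / 6
      ≡⟨ cong (λ z → z * (+ 24 / 1) * (+ 1 / 24) - + 11 / 6) (ι-2+ a) ⟨
    ι (2 ℕ.+ a) * (+ 24 / 1) * (+ 1 / 24) - + 11 / 6
      ≡⟨ cong (λ z → z * (+ 1 / 24) - + 11 / 6) (fromℕ-* (2 ℕ.+ a) 24) ⟨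
    ι ((2 ℕ.+ a) ℕ.* 24) * (+ 1 / 24) - + 11 / 6
      ≤⟨ ℚ.+-monoˡ-≤ (- (+ 11 / 6)) (ℚ.*-monoʳ-≤-nonNeg (+ 1 / 24) (fromℕ-mono-≤ a≤m)) ⟩
    ι m * (+ 1 / 24) - + 11 / 6
      -- The slope is 1 - 23/24 and the constant is -1 + 2 - 17/6.
      ≡⟨ solve 1 (λ z → z :* con (+ 1 / 24) :- con (+ 11 / 6)
                     := con (- 1ℚ) :+ (con 1ℚ :+ (con 1ℚ :+ z)) :- (z :* con (+ 23 / 24) :+ con (+ 17 / 6)))
               refl (ι m) ⟩
    - 1ℚ + (1ℚ + (1ℚ + ι m)) - (ι m * (+ 23 / 24) + + 17 / 6)
      ≡⟨ cong (λ z → - 1ℚ + z - (ι m * (+ 23 / 24) + + 17 / 6)) (ι-2+ m) ⟨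
    - 1ℚ + ι k - (ι m * (+ 23 / 24) + + 17 / 6)
      ≤⟨ ℚ.+-monoʳ-≤ (- 1ℚ + ι k) (ℚ.neg-antimono-≤ (ᵐM₂-≤ m)) ⟩
    - 1ℚ + ι k - ᵐM₂ (T₂-Construction.graph k)
      ≤⟨ s₆-≥ k ⟩
    s₆ (T₂ k) (γ<order-T₂ k) ∎
    where
    open ℚ.≤-Reasoning
    open +-*-Solver
    ι : ℕ → ℚ
    ι n = + n / 1
    ι-2+ : ∀ n → ι (2 ℕ.+ n) ≡ 1ℚ + (1ℚ + ι n)
    ι-2+ n = trans (fromℕ-suc (suc n)) (cong (_+_ 1ℚ) (fromℕ-suc n))
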